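{- A graph $G$ is an R-cocore if and only if $G$ has property N*.
   Context: Graphs are finite, undirected and without loops. For a graph $H$, a finite set $B$ and a relation $R\subseteq V_H\times B$ with full image (every $b\in B$ has some $v\in V_H$ with $(v,b)\in R$), $H\ast R$ denotes the graph with vertex set $B$ and edge set $\{(a,b)\in B\times B:\ \text{there is } (u,v)\in E_H \text{ with } (u,a)\in R,\ (v,b)\in R\}$. All relations are required to have full domain (every $v\in V_H$ has some $b\in B$ with $(v,b)\in R$). Let $H$ be a subgraph of $G$. An R-coretraction of $H$ to $G$ is a relation $R\subseteq V_H\times V_G$ such that $H\ast R=G$ and $(x,x)\in R$ for all $x\in V_H$; in this case $H$ is called an R-coretract of $G$. A graph $G$ is an R-cocore if there is no proper subgraph of $G$ that is an R-coretract of $G$. $N_G(x)$ is the set of vertices adjacent to $x$ in $G$. $G$ has property N* if, for every vertex $x\in V_G$, there is no subset $U_x\subseteq V_G\setminus\{x\}$ such that $N_G(x)=\bigcup_{y\in U_x}N_G(y)$.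
   Formalization: "Subgraph" is read as induced subgraph (otherwise K₄, which has N*, has the perfect matching 2K₂ as a proper R-coretract), and U_x in property N* is required to be non-empty (otherwise K₁ is an R-cocore without N*). -}

module Defs where

open import Level using (0ℓ)
open import Data.Nat using (ℕ)
open import Data.Fin using (Fin)
open import Data.Fin.Properties using (any?)
open import Data.Fin.Subset using (Subset; _∈_; _⊆_; _-_; Nonempty)
open import Data.Product using (∃; ∃-syntax; _×_; _,_)
open import Relation.Binary.Core using (Rel; REL; _⇒_; _⇔_)
open import Relation.Binary.Definitions using (Symmetric; Decidable)
open import Relation.Binary.PropositionalEquality using (_≡_)
open import Relation.Nullary using (¬_)
open import Relation.Nullary.Decidable using (_×-dec_)
open import Relation.Unary using (Pred; _≐_)

-- The vertex set is a subset of an ambient Fin n, so that a graph and its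
-- subgraphs have vertices of the same type.  Loops are allowed here because
-- H ∗ R may have them even when H does not; see Loopless.
record Graph (n : ℕ) : Set₁ where
  field
    V     : Subset n
    E     : Rel (Fin n) 0ℓ
    E?    : Decidable E
    E-sym : Symmetric E
    E⇒∈V  : ∀ {u v} → E u v → u ∈ V

open Graph public

Loopless : ∀ {n} → Graph n → Set
Loopless G = ∀ x → ¬ E G x x

infix 4 _≈_

_≈_ : ∀ {n} → Graph n → Graph n → Set
G ≈ H = V G ≡ V H × (E G ⇔ E H)

-- Subgraphs are induced.  For non-induced ones a vertex can satisfy property
-- N* and yet edges be redundant: every two vertices of K₄ can be linked
-- through a relation from a perfect matching 2K₂ of K₄, containing the
-- diagonal, so 2K₂ ∗ R = K₄, although K₄ has property N*.
record Subgraph {n} (H G : Graph n) : Set where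
  field
    V⊆      : V H ⊆ V G
    E⊆      : E H ⇒ E G
    induced : ∀ {u v} → u ∈ V H → v ∈ V H → E G u v → E H u v

ProperSubgraph : ∀ {n} → Graph n → Graph n → Set
ProperSubgraph H G = Subgraph H G × ¬ (H ≈ G)

record Relation {m n} (A : Subset m) (B : Subset n) : Set₁ where
  field
    rel         : REL (Fin m) (Fin n) 0ℓ
    rel?        : Decidable rel
    rel⇒∈A      : ∀ {a b} → rel a b → a ∈ A
    rel⇒∈B      : ∀ {a b} → rel a b → b ∈ B
    full-domain : ∀ {a} → a ∈ A → ∃[ b ] rel a b
    full-image  : ∀ {b} → b ∈ B → ∃[ a ] rel a b

open Relation public

infixl 7 _∗_

_∗_ : ∀ {m n} (H : Graph m) {B : Subset n} → Relation (V H) B → Graph n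
V (_∗_ H {B} R) = B
E (H ∗ R) a b = ∃[ u ] ∃[ v ] (E H u v × rel R u a × rel R v b)
E? (H ∗ R) a b =
  any? λ u → any? λ v → E? H u v ×-dec (rel? R u a ×-dec rel? R v b)
E-sym (H ∗ R) (u , v , uv , ua , vb) = v , u , E-sym H uv , vb , ua
E⇒∈V (H ∗ R) (u , v , uv , ua , vb) = rel⇒∈B R ua

record IsRCoretraction {n} (H G : Graph n) (R : Relation (V H) (V G)) : Set where
  field
    H∗R≈G     : H ∗ R ≈ G
    reflexive : ∀ {x} → x ∈ V H → rel R x x

RCoretract : ∀ {n} → Graph n → Graph n → Set₁
RCoretract H G = Subgraph H G × ∃ (IsRCoretraction H G)

IsRCocore : ∀ {n} → Graph n → Set₁
IsRCocore {n} G = ¬ (∃[ H ] (ProperSubgraph H G × RCoretract H G))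

N : ∀ {n} → Graph n → Fin n → Pred (Fin n) 0ℓ
N G x y = E G x y

⋃N : ∀ {n} → Graph n → Subset n → Pred (Fin n) 0ℓ
⋃N G U z = ∃[ y ] (y ∈ U × N G y z)

-- U has to be non-empty: otherwise an isolated vertex x would violate the
-- property through N(x) = ∅, whereas for instance K₁ is an R-cocore.  If x is
-- not isolated, N(x) = ⋃N U already forces U to be non-empty.
PropertyN* : ∀ {n} → Graph n → Set
PropertyN* G = ∀ x → x ∈ V G →
  ¬ (∃[ U ] (Nonempty U × U ⊆ V G - x × N G x ≐ ⋃N G U))

{-# OPTIONS --safe #-}
module Submission where

-- If N(x) = ⋃ N(y) over y ∈ U, then G - x is an R-coretract of G through the
-- relation that is the identity off x and replaces x by all of U.  Conversely,
-- given an R-coretraction R of H to G and a vertex x of G outside H, the set U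
-- of all u with (u, x) ∈ R satisfies N(x) = ⋃ N(u): as R contains the diagonal
-- of H, an edge of G witnessed by an edge u'v' of H, where (v', b) ∈ R, may be
-- routed through v', and H being induced lets it be pulled back to H.

open import Defs
open import Data.Fin using (Fin; zero; suc; _≟_)
open import Data.Fin.Properties using (¬∀⟶∃¬)
open import Data.Fin.Subset using (Subset; _∈_; _∉_; _⊆_; _-_; ⁅_⁆; Nonempty)
open import Data.Fin.Subset.Properties
  using (_∈?_; ⊆-antisym; p─q⊆p; x∈p∧x≢y⇒x∈p-y)
open import Data.Nat using (ℕ)
open import Data.Product using (∃-syntax; _×_; _,_)
open import Data.Sum using (_⊎_; inj₁; inj₂)
open import Data.Vec using (_∷_; tabulate; there)
open import Data.Vec.Properties using ([]=⇒lookup; lookup⇒[]=; lookup∘tabulate)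
open import Function.Bundles using (_⇔_; mk⇔)
open import Relation.Binary.PropositionalEquality
  using (_≡_; _≢_; refl; sym; trans; subst)
open import Relation.Nullary using (¬_; yes; no; does; contradiction)
open import Relation.Nullary.Decidable
  using (dec-true; decidable-stable; ¬?; _×-dec_; _⊎-dec_; _→-dec_)
open import Relation.Unary using (Pred; Decidable; _≐_)

private variable
  n : ℕ

x∉p-x : ∀ (p : Subset n) x → x ∉ p - x
x∉p-x (_ ∷ p) zero    ()
x∉p-x (_ ∷ p) (suc x) (there x∈) = x∉p-x p x x∈

x∈p-y⇒x≢y : ∀ {p : Subset n} {x y} → x ∈ p - y → x ≢ y
x∈p-y⇒x≢y {p = p} {x} x∈ refl = x∉p-x p x x∈

module _ {ℓ} {P : Pred (Fin n) ℓ} (P? : Decidable P) where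

  -- `PropertyN*` ranges over values of `Subset`, so the preimage of a vertex under a relation has
  -- to become such a value; decidability provides its characteristic vector.
  separate : Subset n
  separate = tabulate λ x → does (P? x)

  separate⁺ : ∀ {x} → P x → x ∈ separate
  separate⁺ {x} px =
    lookup⇒[]= x separate (trans (lookup∘tabulate _ x) (dec-true (P? x) px))

  separate⁻ : ∀ {x} → x ∈ separate → P x
  separate⁻ {x} x∈
    with P? x | trans (sym (lookup∘tabulate (λ y → does (P? y)) x)) ([]=⇒lookup x∈)
  ... | yes px | _  = px
  ... | no _   | ()

infixl 8 _∖_

_∖_ : Graph n → Fin n → Graph n
V (G ∖ x)                            = V G - x
E (G ∖ x) u v                        = E G u v × u ≢ x × v ≢ x
E? (G ∖ x) u v                       = E? G u v ×-dec ¬? (u ≟ x) ×-dec ¬? (v ≟ x)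
E-sym (G ∖ x) (uv , u≢x , v≢x)       = E-sym G uv , v≢x , u≢x
E⇒∈V (G ∖ x) (uv , u≢x , _)          = x∈p∧x≢y⇒x∈p-y (E⇒∈V G uv) u≢x

∖-subgraph : ∀ (G : Graph n) x → Subgraph (G ∖ x) G
∖-subgraph G x = record
  { V⊆      = p─q⊆p (V G) ⁅ x ⁆
  ; E⊆      = λ (uv , _) → uv
  ; induced = λ u∈ v∈ uv → uv , x∈p-y⇒x≢y u∈ , x∈p-y⇒x≢y v∈
  }

∖-proper : ∀ (G : Graph n) {x} → x ∈ V G → ProperSubgraph (G ∖ x) G
∖-proper G {x} x∈ =
  ∖-subgraph G x , λ (V≡ , _) → x∉p-x (V G) x (subst (x ∈_) (sym V≡) x∈)

module _ (G : Graph n) {x} (x∈ : x ∈ V G) {U : Subset n}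
         (U≢∅ : Nonempty U) (U⊆ : U ⊆ V G - x) where

  -- The conjunct `a ∈ V G - x` excludes the pair of `x` with itself from the identity part, so that
  -- `x` has exactly the elements of `U` as preimages; full image at `x` therefore rests on `U≢∅`.
  replace : Relation (V (G ∖ x)) (V G)
  replace = record
    { rel         = λ a b → a ∈ V G - x × (a ≡ b ⊎ (a ∈ U × b ≡ x))
    ; rel?        = λ a b → (a ∈? V G - x) ×-dec ((a ≟ b) ⊎-dec ((a ∈? U) ×-dec (b ≟ x)))
    ; rel⇒∈A      = λ (a∈ , _) → a∈
    ; rel⇒∈B      = λ { (a∈ , inj₁ refl)       → p─q⊆p (V G) ⁅ x ⁆ a∈
                      ; (_  , inj₂ (_ , refl)) → x∈ }
    ; full-domain = λ {a} a∈ → a , a∈ , inj₁ refl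
    ; full-image  = image
    }
    where
    image : ∀ {b} → b ∈ V G → ∃[ a ] (a ∈ V G - x × (a ≡ b ⊎ (a ∈ U × b ≡ x)))
    image {b} b∈ with b ≟ x
    ... | yes b≡x = let u , u∈ = U≢∅ in u , U⊆ u∈ , inj₂ (u∈ , b≡x)
    ... | no  b≢x = b , x∈p∧x≢y⇒x∈p-y b∈ b≢x , inj₁ refl

  -- The inclusion `⋃⊆N` shows that the product creates no edge outside `G`, and `N⊆⋃` that the
  -- edges at `x` are recovered.
  replace-isRCoretraction : Loopless G → N G x ≐ ⋃N G U →
                            IsRCoretraction (G ∖ x) G replace
  replace-isRCoretraction loopless (N⊆⋃ , ⋃⊆N) = record
    { H∗R≈G     = refl , to , from
    ; reflexive = λ y∈ → y∈ , inj₁ refl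
    }
    where
    to : ∀ {a b} → E (G ∖ x ∗ replace) a b → E G a b
    to (_ , _ , (uv , _) , (_ , inj₁ refl)       , (_ , inj₁ refl))       = uv
    to (u , _ , (uv , _) , (_ , inj₂ (u∈ , refl)) , (_ , inj₁ refl))      = ⋃⊆N (u , u∈ , uv)
    to (_ , v , (uv , _) , (_ , inj₁ refl)       , (_ , inj₂ (v∈ , refl))) =
      E-sym G (⋃⊆N (v , v∈ , E-sym G uv))
    -- An edge uv inside U puts v into N(x), hence x into N(v) ⊆ N(x).
    to (u , v , (uv , _) , (_ , inj₂ (u∈ , refl)) , (_ , inj₂ (v∈ , refl))) =
      ⋃⊆N (v , v∈ , E-sym G (⋃⊆N (u , u∈ , uv)))

    stays : ∀ {y} → y ∈ V G → y ≢ x → rel replace y y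
    stays y∈ y≢x = x∈p∧x≢y⇒x∈p-y y∈ y≢x , inj₁ refl

    -- Some `u` in `U` is adjacent to `b`; it stands in for `x`, while `b` represents itself.
    throughU : ∀ {b} → E G x b → b ≢ x → E (G ∖ x ∗ replace) x b
    throughU {b} xb b≢x with N⊆⋃ xb
    ... | u , u∈ , ub =
      u , b , (ub , x∈p-y⇒x≢y (U⊆ u∈) , b≢x) ,
      (U⊆ u∈ , inj₂ (u∈ , refl)) , stays (E⇒∈V G (E-sym G xb)) b≢x

    from : ∀ {a b} → E G a b → E (G ∖ x ∗ replace) a b
    from {a} {b} ab with a ≟ x | b ≟ x
    -- A loop at `x` is out of reach of `throughU`; looplessness excludes it.
    ... | yes refl | yes refl = contradiction ab (loopless x)
    ... | yes refl | no b≢x   = throughU ab b≢x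
    ... | no a≢x   | yes refl = E-sym (G ∖ x ∗ replace) (throughU (E-sym G ab) a≢x)
    ... | no a≢x   | no b≢x   =
      a , b , (ab , a≢x , b≢x) , stays (E⇒∈V G ab) a≢x , stays (E⇒∈V G (E-sym G ab)) b≢x

rCocore⇒N* : ∀ (G : Graph n) → Loopless G → IsRCocore G → PropertyN* G
rCocore⇒N* G loopless cocore x x∈ (U , U≢∅ , U⊆ , N≐⋃) =
  cocore ( G ∖ x , ∖-proper G x∈ , ∖-subgraph G x
         , replace G x∈ U≢∅ U⊆ , replace-isRCoretraction G x∈ U≢∅ U⊆ loopless N≐⋃ )

-- An induced subgraph containing all vertices has all edges as well, so it is not proper.
-- Finiteness and decidable membership turn this into a witness.
proper⇒missing-vertex : ∀ {H G : Graph n} → ProperSubgraph H G → ∃[ x ] (x ∈ V G × x ∉ V H)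
proper⇒missing-vertex {n} {H} {G} (H⊆G , H≉G)
  with ¬∀⟶∃¬ n _ (λ x → (x ∈? V G) →-dec (x ∈? V H)) spanning⇒⊥
  where
  open Subgraph H⊆G
  spanning⇒⊥ : ¬ (∀ x → x ∈ V G → x ∈ V H)
  spanning⇒⊥ G⊆H = H≉G
    ( ⊆-antisym V⊆ (λ {x} → G⊆H x) , E⊆
    , λ uv → induced (G⊆H _ (E⇒∈V G uv)) (G⊆H _ (E⇒∈V G (E-sym G uv))) uv )
... | x , x∉ =
  x , decidable-stable (x ∈? V G) (λ x∉G → x∉ λ x∈G → contradiction x∈G x∉G)
    , λ x∈H → x∉ λ _ → x∈H

-- For `x` in `H` the diagonal puts `x` itself into this set, so the set can contradict property N*
-- only when `x` lies outside `H`.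
coretraction⇒N≐⋃N : ∀ {H G : Graph n} {R} → Subgraph H G → IsRCoretraction H G R →
                    ∀ x → N G x ≐ ⋃N G (separate λ u → rel? R u x)
coretraction⇒N≐⋃N {H = H} {G} {R} H⊆G retr x = N⊆⋃ , ⋃⊆N
  where
  open Subgraph H⊆G
  open IsRCoretraction retr

  ∗⇒G : ∀ {a b} → E (H ∗ R) a b → E G a b
  ∗⇒G = let _ , to , _ = H∗R≈G in to

  G⇒∗ : ∀ {a b} → E G a b → E (H ∗ R) a b
  G⇒∗ = let _ , _ , from = H∗R≈G in from

  R? = λ u → rel? R u x

  N⊆⋃ : ∀ {b} → E G x b → ⋃N G (separate R?) b
  N⊆⋃ xb with G⇒∗ xb
  ... | u , v , uv , ux , vb =
    -- The edge `uv` of `H` is used again, with `u` now related to itself instead of to `x`.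
    u , separate⁺ R? ux , ∗⇒G (u , v , uv , reflexive (E⇒∈V H uv) , vb)

  ⋃⊆N : ∀ {b} → ⋃N G (separate R?) b → E G x b
  ⋃⊆N (u , u∈ , ub) with G⇒∗ ub
  ... | u′ , v′ , u′v′ , u′u , v′b = ∗⇒G (u , v′ , uv′ , ux , v′b)
    where
    ux : rel R u x
    ux = separate⁻ R? u∈

    v′∈ : v′ ∈ V H
    v′∈ = E⇒∈V H (E-sym H u′v′)

    uv′ : E H u v′
    -- Relating `v′` to itself instead of to `b` makes `u′v′` witness an edge `uv′` of `G`, both
    -- ends of which lie in `H`.
    uv′ = induced (rel⇒∈A R ux) v′∈ (∗⇒G (u′ , v′ , u′v′ , u′u , reflexive v′∈))

-- A vertex missing from `H` has preimages by full image, and these lie in `H`, hence differ from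
-- it; they form a set that N* forbids.
N*⇒rCocore : ∀ (G : Graph n) → PropertyN* G → IsRCocore G
N*⇒rCocore G n* (H , proper , H⊆G , R , retr) with proper⇒missing-vertex proper
... | x , x∈G , x∉H with full-image R x∈G
... | u , ux = n* x x∈G
  ( separate R? , (u , separate⁺ R? ux) , U⊆ , coretraction⇒N≐⋃N H⊆G retr x )
  where
  R? = λ u → rel? R u x

  U⊆ : separate R? ⊆ V G - x
  U⊆ u∈ = x∈p∧x≢y⇒x∈p-y (Subgraph.V⊆ H⊆G u∈H) λ { refl → x∉H u∈H }
    where u∈H = rel⇒∈A R (separate⁻ R? u∈)

proposition4p4p10 : ∀ {n : ℕ} (G : Graph n) → Loopless G → IsRCocore G ⇔ PropertyN* G
proposition4p4p10 G loopless = mk⇔ (rCocore⇒N* G loopless) (N*⇒rCocore G)
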